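{- Let $X$, $Y$ be graphs, let $\varphi:X\to Y$ be a homomorphism which is both locally surjective and component equitable, and let $y\in V_Y$. Then $c(X)_y=\frac{k_X(y)}{k_C(y)}$ for all $C\in\mathcal{C}(X)_y$. In particular, $k_C(y)$ divides $k_X(y)$ for all $C\in\mathcal{C}(X)_y$.
   Context: All graphs are finite, undirected, simple and reflexive: a graph $X=(V_X,E_X)$ has a finite nonempty vertex set $V_X$, and $E_X$ consists of all loops $\{x\}$ ($x\in V_X$; written $\{x,x\}$) together with a (possibly empty) set of $2$-element subsets of $V_X$. A homomorphism $\varphi:X\to Y$ is a map $\varphi:V_X\to V_Y$ such that $\{x_1,x_2\}\in E_X$ implies $\{\varphi(x_1),\varphi(x_2)\}\in E_Y$. $N_X(x)=\{u\in V_X:\{x,u\}\in E_X\}$ (so $x\in N_X(x)$). $\varphi$ is locally surjective if $\varphi(N_X(x))=N_Y(\varphi(x))$ for all $x\in V_X$. $\mathcal{C}(X)$ is the set of components (maximal connected subgraphs) of $X$. For $y\in V_Y$ and a subgraph $\hat X$ of $X$, $k_{\hat X}(y)=|V_{\hat X}\cap\varphi^{ -1}(y)|$ (so $k_X(y)=|\varphi^{ -1}(y)|$); $\mathcal{C}(X)_y=\{C\in\mathcal{C}(X):k_C(y)>0\}$ and $c(X)_y=|\mathcal{C}(X)_y|$. $\varphi$ is component equitable if for every $y\in V_Y$ and all $C,\hat C\in\mathcal{C}(X)_y$ one has $k_C(y)=k_{\hat C}(y)$. -}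

module Defs where

open import Data.Bool.Base using (Bool; true; false)
open import Data.Fin.Base using (Fin)
open import Data.Fin.Properties using (_≟_; all?; any?)
open import Data.Fin.Subset using (Subset; _∈_; _⊆_; _⊃_; _∪_; _∩_; ⁅_⁆; ⊤; ∣_∣; Nonempty)
open import Data.Fin.Subset.Induction using (⊃-wellFounded)
open import Data.Fin.Subset.Properties using (_∈?_; _⊆?_; nonempty?; x∈⁅x⁆; x∈⁅y⁆⇒x≡y; p⊆p∪q; x∈p∪q⁻; x∈p∪q⁺)
open import Data.List.Base using (List; []; _∷_; [_]; length; filter; cartesianProductWith)
import Data.List.Membership.Propositional as List
open import Data.List.Membership.Propositional.Properties using (∈-cartesianProductWith⁺)
import Data.List.Relation.Unary.All as All
import Data.List.Relation.Unary.AllPairs as AllPairs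
open import Data.List.Relation.Unary.Any using (here; there)
open import Data.List.Relation.Unary.Unique.Propositional using (Unique)
open import Data.List.Relation.Unary.Unique.Propositional.Properties using (cartesianProductWith⁺)
open import Data.Nat.Base using (ℕ; zero; suc; _<_; NonZero)
open import Data.Nat.Properties using (_<?_)
open import Data.Product.Base using (_×_; _,_; ∃)
open import Data.Sum.Base using (inj₁; inj₂)
open import Data.Vec.Base using (Vec; []; _∷_; lookup; tabulate)
open import Data.Vec.Properties using (∷-injective)
open import Induction.WellFounded using (Acc; acc)
open import Level using (0ℓ)
open import Relation.Binary.Construct.Closure.ReflexiveTransitive using (Star; ε; _◅_; _◅◅_)
open import Relation.Binary.Core using (Rel; _=[_]⇒_)
open import Relation.Binary.Definitions using (Decidable; Reflexive; Symmetric)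
open import Relation.Binary.PropositionalEquality using (_≡_; refl)
open import Relation.Nullary.Decidable using (Dec; yes; no; does; map′; ¬?; _×-dec_; _→-dec_)
open import Relation.Nullary.Negation using (contradiction)
open import Relation.Unary using (Pred; _≐_)

-- The edge set is given as the adjacency relation: Edge u v means {u,v} ∈ E.

record Graph : Set₁ where
  field
    order          : ℕ
    {{nonempty}}   : NonZero order
    Edge           : Rel (Fin order) 0ℓ
    edge?          : Decidable Edge
    edge-refl      : Reflexive Edge
    edge-sym       : Symmetric Edge

  Vertex : Set
  Vertex = Fin order

  N : Vertex → Pred Vertex 0ℓ
  N x u = Edge x u

open Graph public using (Vertex; N)

record Homomorphism (X Y : Graph) : Set where
  field
    map       : Vertex X → Vertex Y
    preserves : Graph.Edge X =[ map ]⇒ Graph.Edge Y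

open Homomorphism public using (map)

Image : {A B : Set} → (A → B) → Pred A 0ℓ → Pred B 0ℓ
Image f P b = ∃ λ a → P a × f a ≡ b

LocallySurjective : {X Y : Graph} → Homomorphism X Y → Set
LocallySurjective {X} {Y} φ = ∀ x → Image (map φ) (N X x) ≐ N Y (map φ x)

-- A RawSubgraph consists of bit vectors (a vertex set and an adjacency matrix),
-- with a separate predicate IsSubgraph, so that propositional equality is
-- equality of subgraphs and they can be enumerated and counted.

record RawSubgraph (X : Graph) : Set where
  constructor subgraph
  field
    vertices  : Subset (Graph.order X)
    adjacency : Vec (Subset (Graph.order X)) (Graph.order X)

  Adj : Rel (Vertex X) 0ℓ
  Adj u v = v ∈ lookup adjacency u

open RawSubgraph public

record IsSubgraph (X : Graph) (H : RawSubgraph X) : Set where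
  field
    nonempty  : Nonempty (vertices H)
    loops     : ∀ u → u ∈ vertices H → Adj H u u
    symmetric : ∀ u v → Adj H u v → Adj H v u
    endpoints : ∀ u v → Adj H u v → u ∈ vertices H × v ∈ vertices H
    edges     : ∀ u v → Adj H u v → Graph.Edge X u v

whole : (X : Graph) → RawSubgraph X
whole X = subgraph ⊤ (tabulate λ u → tabulate λ v → does (Graph.edge? X u v))

Connected : {X : Graph} → RawSubgraph X → Set
Connected H = ∀ u v → u ∈ vertices H → v ∈ vertices H → Star (Adj H) u v

infix 4 _⊑_

_⊑_ : {X : Graph} → RawSubgraph X → RawSubgraph X → Set
H ⊑ K = vertices H ⊆ vertices K × (∀ u v → Adj H u v → Adj K u v)

IsConnectedSubgraph : (X : Graph) → RawSubgraph X → Set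
IsConnectedSubgraph X H = IsSubgraph X H × Connected H

IsComponent : (X : Graph) → RawSubgraph X → Set
IsComponent X C =
  IsConnectedSubgraph X C × (∀ H → IsConnectedSubgraph X H → C ⊑ H → H ⊑ C)

module _ {X Y : Graph} (φ : Homomorphism X Y) where

  fibre : Vertex Y → Subset (Graph.order X)
  fibre y = tabulate λ x → does (map φ x ≟ y)

  k : RawSubgraph X → Vertex Y → ℕ
  k H y = ∣ vertices H ∩ fibre y ∣

  𝒞 : Vertex Y → Pred (RawSubgraph X) 0ℓ
  𝒞 y C = IsComponent X C × 0 < k C y

  ComponentEquitable : Set
  ComponentEquitable = ∀ y C C′ → 𝒞 y C → 𝒞 y C′ → k C y ≡ k C′ y

-- It remains to count 𝒞 y: enumerate all RawSubgraphs without repetition and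
-- filter the list by a decision procedure for 𝒞 y.

vectors : {A : Set} → List A → (n : ℕ) → List (Vec A n)
vectors as zero    = [ [] ]
vectors as (suc n) = cartesianProductWith _∷_ as (vectors as n)

vectors-complete : {A : Set} {as : List A} → (∀ a → a List.∈ as) →
                   ∀ {n} (v : Vec A n) → v List.∈ vectors as n
vectors-complete all []      = here refl
vectors-complete all (a ∷ v) = ∈-cartesianProductWith⁺ _∷_ (all a) (vectors-complete all v)

vectors-unique : {A : Set} {as : List A} → Unique as → ∀ n → Unique (vectors as n)
vectors-unique u zero    = All.[] AllPairs.∷ AllPairs.[]
vectors-unique u (suc n) = cartesianProductWith⁺ _∷_ ∷-injective u (vectors-unique u n)

booleans : List Bool
booleans = true ∷ false ∷ []

booleans-complete : ∀ b → b List.∈ booleans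
booleans-complete true  = here refl
booleans-complete false = there (here refl)

booleans-unique : Unique booleans
booleans-unique = ((λ ()) All.∷ All.[]) AllPairs.∷ All.[] AllPairs.∷ AllPairs.[]

subgraphs : (X : Graph) → List (RawSubgraph X)
subgraphs X = cartesianProductWith subgraph (vectors booleans n) (vectors (vectors booleans n) n)
  where n = Graph.order X

subgraphs-complete : ∀ X (H : RawSubgraph X) → H List.∈ subgraphs X
subgraphs-complete X (subgraph V A) =
  ∈-cartesianProductWith⁺ subgraph
    (vectors-complete booleans-complete V)
    (vectors-complete (vectors-complete booleans-complete) A)

subgraphs-unique : ∀ X → Unique (subgraphs X)
subgraphs-unique X =
  cartesianProductWith⁺ subgraph (λ { refl → refl , refl })
    (vectors-unique booleans-unique n)
    (vectors-unique (vectors-unique booleans-unique n) n)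
  where n = Graph.order X

-- Reachability is decided by growing a set S of vertices reachable from u
-- until it is closed under R.

module _ {n : ℕ} {R : Rel (Fin n) 0ℓ} (R? : Decidable R) where

  private
    closed : {S : Subset n} → (∀ {s t} → s ∈ S → R s t → t ∈ S) →
             ∀ {s t} → s ∈ S → Star R s t → t ∈ S
    closed step s∈S ε        = s∈S
    closed step s∈S (r ◅ rs) = closed step (step s∈S r) rs

    grow : ∀ {u} (S : Subset n) → Acc _⊃_ S → u ∈ S →
           (∀ {s} → s ∈ S → Star R u s) → ∀ v → Dec (Star R u v)
    grow {u} S (acc rec) u∈S reach v
      with any? (λ s → any? (λ t → s ∈? S ×-dec ¬? (t ∈? S) ×-dec R? s t))
    ... | yes (s , t , s∈S , t∉S , r) =
      grow (S ∪ ⁅ t ⁆)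
        (rec (p⊆p∪q ⁅ t ⁆ , t , x∈p∪q⁺ (inj₂ (x∈⁅x⁆ t)) , t∉S))
        (p⊆p∪q ⁅ t ⁆ u∈S) reach′ v
      where
      reach′ : ∀ {w} → w ∈ S ∪ ⁅ t ⁆ → Star R u w
      reach′ w∈ with x∈p∪q⁻ S ⁅ t ⁆ w∈
      ... | inj₁ w∈S = reach w∈S
      ... | inj₂ w∈t with refl ← x∈⁅y⁆⇒x≡y t w∈t = reach s∈S ◅◅ (r ◅ ε)
    ... | no ∄ = map′ reach (closed step u∈S) (v ∈? S)
      where
      step : ∀ {s t} → s ∈ S → R s t → t ∈ S
      step {s} {t} s∈S r with t ∈? S
      ... | yes t∈S = t∈S
      ... | no  t∉S = contradiction (s , t , s∈S , t∉S , r) ∄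

  star? : Decidable (Star R)
  star? u v = grow ⁅ u ⁆ (⊃-wellFounded ⁅ u ⁆) (x∈⁅x⁆ u) reach v
    where
    reach : ∀ {s} → s ∈ ⁅ u ⁆ → Star R u s
    reach s∈ with refl ← x∈⁅y⁆⇒x≡y u s∈ = ε

module _ {X : Graph} where

  adj? : (H : RawSubgraph X) → Decidable (Adj H)
  adj? H u v = v ∈? lookup (adjacency H) u

  isSubgraph? : (H : RawSubgraph X) → Dec (IsSubgraph X H)
  isSubgraph? H = map′
    (λ (a , b , c , d , e) → record
      { nonempty = a ; loops = b ; symmetric = c ; endpoints = d ; edges = e })
    (λ s → let open IsSubgraph s in nonempty , loops , symmetric , endpoints , edges)
    (nonempty? (vertices H)
      ×-dec all? (λ u → u ∈? vertices H →-dec adj? H u u)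
      ×-dec all? (λ u → all? λ v → adj? H u v →-dec adj? H v u)
      ×-dec all? (λ u → all? λ v → adj? H u v →-dec (u ∈? vertices H ×-dec v ∈? vertices H))
      ×-dec all? (λ u → all? λ v → adj? H u v →-dec Graph.edge? X u v))

  connected? : (H : RawSubgraph X) → Dec (Connected H)
  connected? H = all? λ u → all? λ v →
    u ∈? vertices H →-dec (v ∈? vertices H →-dec star? (adj? H) u v)

  _⊑?_ : Decidable (_⊑_ {X})
  H ⊑? K = vertices H ⊆? vertices K
    ×-dec all? λ u → all? λ v → adj? H u v →-dec adj? K u v

  isConnectedSubgraph? : (H : RawSubgraph X) → Dec (IsConnectedSubgraph X H)
  isConnectedSubgraph? H = isSubgraph? H ×-dec connected? H

  isComponent? : (C : RawSubgraph X) → Dec (IsComponent X C)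
  isComponent? C = isConnectedSubgraph? C ×-dec map′
    (λ all H → All.lookup all (subgraphs-complete X H))
    (λ f → All.tabulate λ {H} _ → f H)
    (All.all? (λ H → isConnectedSubgraph? H →-dec (C ⊑? H →-dec H ⊑? C)) (subgraphs X))

module _ {X Y : Graph} (φ : Homomorphism X Y) where

  𝒞? : ∀ y (C : RawSubgraph X) → Dec (𝒞 φ y C)
  𝒞? y C = isComponent? C ×-dec 0 <? k φ C y

  c : Vertex Y → ℕ
  c y = length (filter (𝒞? y) (subgraphs X))

{-# OPTIONS --safe #-}
module Submission where

-- Each vertex x lies in exactly one component, the subgraph induced on the
-- vertices reachable from x, so the sets V_C ∩ φ⁻¹(y) for C ∈ 𝒞(X)_y partition
-- φ⁻¹(y).  Equitability makes them all of the same size k_C(y), whence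
-- k_X(y) = c(X)_y · k_C(y).

open import Defs
open import Data.Bool.Base using (true)
open import Data.Fin.Base using (Fin)
open import Data.Fin.Subset
  using (Subset; inside; outside; _∈_; _⊆_; _∪_; _∩_; ⋃; ∣_∣; Empty)
open import Data.Fin.Subset.Properties
  using (∉⊥; ∣⊥∣≡0; ⊆-antisym; drop-∷-Empty; ∩-identityˡ; x∈p∩q⁺; x∈p∩q⁻; x∈p∪q⁺; x∈p∪q⁻)
open import Data.Integer.Base using (+_)
open import Data.Integer.Properties as ℤ using (pos-*)
open import Data.List.Base as List using (List; []; _∷_; length; filter)
import Data.List.Membership.Propositional as List
open import Data.List.Membership.Propositional.Properties using (∈-filter⁺)
open import Data.List.Properties using (length-map)
open import Data.List.Relation.Unary.All as All using (All; []; _∷_)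
import Data.List.Relation.Unary.All.Properties as All
open import Data.List.Relation.Unary.AllPairs using (AllPairs; []; _∷_)
import Data.List.Relation.Unary.AllPairs.Properties as AllPairs
open import Data.List.Relation.Unary.Any as Any using (Any; here; there)
import Data.List.Relation.Unary.Any.Properties as Any
open import Data.List.Relation.Unary.Unique.Propositional using (Unique)
import Data.List.Relation.Unary.Unique.Propositional.Properties as Unique
open import Data.Nat.Base using (ℕ; suc; _+_; _*_; _<_; z≤n; s≤s; NonZero; >-nonZero)
open import Data.Nat.Divisibility using (_∣_; divides)
open import Data.Nat.Properties using (+-suc)
open import Data.Product.Base using (_×_; _,_; proj₁; proj₂)
open import Data.Rational.Base using (_/_)
open import Data.Rational.Properties using (fromℚᵘ-cong)
open import Data.Rational.Unnormalised.Base using (mkℚᵘ; *≡*)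
open import Data.Sum.Base using (inj₁; inj₂)
open import Data.Vec.Base using ([]; _∷_; here; there; lookup; tabulate)
open import Data.Vec.Properties using ([]=⇒lookup; lookup⇒[]=; lookup∘tabulate)
open import Data.Vec.Relation.Binary.Pointwise.Extensional using (ext; Pointwise-≡⇒≡)
open import Function.Base using (_∘_)
open import Level using (0ℓ)
open import Relation.Binary.Construct.Closure.ReflexiveTransitive
  as Star using (Star; ε; _◅_; _◅◅_; reverse)
open import Relation.Binary.Core using (Rel)
open import Relation.Binary.PropositionalEquality
  using (_≡_; _≢_; refl; sym; trans; cong; cong₂; subst; module ≡-Reasoning)
open import Relation.Nullary.Decidable using (Dec; yes; does; dec-true; _×-dec_)
open import Relation.Nullary.Negation using (contradiction)
open import Relation.Unary using (Pred; Decidable)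

-- Turns an enumeration without repetition into pairwise disjointness: `R` is available only for
-- distinct entries that satisfy `P`, so `P` is carried along the list.
unique⇒allPairs : {A : Set} {P : Pred A 0ℓ} {R : Rel A 0ℓ} {xs : List A} →
                  (∀ {x y} → P x → P y → x ≢ y → R x y) →
                  All P xs → Unique xs → AllPairs R xs
unique⇒allPairs f []         []       = []
unique⇒allPairs f (px ∷ pxs) (x∉ ∷ u) =
  All.zipWith (λ (py , x≢y) → f px py x≢y) (pxs , x∉) ∷ unique⇒allPairs f pxs u

module _ {n : ℕ} where

  module _ {P : Pred (Fin n) 0ℓ} (P? : Decidable P) where

    ∈-tabulate⁺ : ∀ {x} → P x → x ∈ tabulate (does ∘ P?)
    ∈-tabulate⁺ {x} px =
      lookup⇒[]= x _ (trans (lookup∘tabulate (does ∘ P?) x) (dec-true (P? x) px))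

    ∈-tabulate⁻ : ∀ {x} → x ∈ tabulate (does ∘ P?) → P x
    ∈-tabulate⁻ {x} x∈ =
      holds (P? x) (trans (sym (lookup∘tabulate (does ∘ P?) x)) ([]=⇒lookup x∈))
      where
      -- The `no` case is absent because its hypothesis would be `false ≡ true`.
      holds : ∀ {A : Set} (a? : Dec A) → does a? ≡ true → A
      holds (yes a) _ = a

  x∈⋃⁺ : ∀ {x} {ps : List (Subset n)} → Any (x ∈_) ps → x ∈ ⋃ ps
  x∈⋃⁺ (here x∈p) = x∈p∪q⁺ (inj₁ x∈p)
  x∈⋃⁺ (there x∈) = x∈p∪q⁺ (inj₂ (x∈⋃⁺ x∈))

  x∈⋃⁻ : ∀ {x} (ps : List (Subset n)) → x ∈ ⋃ ps → Any (x ∈_) ps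
  x∈⋃⁻ []       x∈ = contradiction x∈ ∉⊥
  x∈⋃⁻ (p ∷ ps) x∈ with x∈p∪q⁻ p (⋃ ps) x∈
  ... | inj₁ x∈p  = here x∈p
  ... | inj₂ x∈ps = there (x∈⋃⁻ ps x∈ps)

Disjoint : ∀ {n} → Rel (Subset n) 0ℓ
Disjoint p q = Empty (p ∩ q)

∣p∪q∣≡∣p∣+∣q∣ : ∀ {n} (p q : Subset n) → Disjoint p q → ∣ p ∪ q ∣ ≡ ∣ p ∣ + ∣ q ∣
∣p∪q∣≡∣p∣+∣q∣ []            []            _ = refl
∣p∪q∣≡∣p∣+∣q∣ (inside  ∷ p) (inside  ∷ q) d = contradiction (_ , here) d
∣p∪q∣≡∣p∣+∣q∣ (inside  ∷ p) (outside ∷ q) d = cong suc (∣p∪q∣≡∣p∣+∣q∣ p q (drop-∷-Empty d))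
∣p∪q∣≡∣p∣+∣q∣ (outside ∷ p) (inside  ∷ q) d =
  trans (cong suc (∣p∪q∣≡∣p∣+∣q∣ p q (drop-∷-Empty d))) (sym (+-suc ∣ p ∣ ∣ q ∣))
∣p∪q∣≡∣p∣+∣q∣ (outside ∷ p) (outside ∷ q) d = ∣p∪q∣≡∣p∣+∣q∣ p q (drop-∷-Empty d)

-- A common point would lie in some member of `qs`, against the disjointness of that member from
-- `p`.
disjoint-⋃ : ∀ {n} {p : Subset n} {qs} → All (Disjoint p) qs → Disjoint p (⋃ qs)
disjoint-⋃ {p = p} {qs} ds (x , x∈) with x∈p , x∈⋃ ← x∈p∩q⁻ p (⋃ qs) x∈ =
  All.lookupWith (λ d x∈q → d (x , x∈p∩q⁺ (x∈p , x∈q))) ds (x∈⋃⁻ qs x∈⋃)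

-- Each set is disjoint from the union of those after it, so it contributes exactly `m` new
-- elements.
∣⋃∣-equitable : ∀ {n m} {ps : List (Subset n)} → AllPairs Disjoint ps →
                All (λ p → ∣ p ∣ ≡ m) ps → ∣ ⋃ ps ∣ ≡ length ps * m
∣⋃∣-equitable {n} []                []         = ∣⊥∣≡0 n
∣⋃∣-equitable {ps = p ∷ ps} (d ∷ ds) (eq ∷ eqs) =
  trans (∣p∪q∣≡∣p∣+∣q∣ p (⋃ ps) (disjoint-⋃ d)) (cong₂ _+_ eq (∣⋃∣-equitable ds eqs))

x∈p⇒0<∣p∣ : ∀ {n x} {p : Subset n} → x ∈ p → 0 < ∣ p ∣
x∈p⇒0<∣p∣ {p = inside  ∷ p} _           = s≤s z≤n
x∈p⇒0<∣p∣ {p = outside ∷ p} (there x∈p) = x∈p⇒0<∣p∣ x∈p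

module _ {X : Graph} where

  open Graph X using (Edge; edge?; edge-refl; edge-sym)

  -- Vertex sets and adjacency rows are bit vectors, so mutual inclusion makes them equal; the
  -- matrices then agree row by row.
  ⊑-antisym : {H K : RawSubgraph X} → H ⊑ K → K ⊑ H → H ≡ K
  ⊑-antisym (V⊆ , A⊆) (V⊇ , A⊇) =
    cong₂ subgraph (⊆-antisym V⊆ V⊇)
      (Pointwise-≡⇒≡ (ext λ u → ⊆-antisym (A⊆ u _) (A⊇ u _)))

  reachable? : ∀ x → Decidable (Star Edge x)
  reachable? = star? edge?

  -- Reachability is asked of `u` alone, since the edge passes it on to `v`; the rows built from
  -- this are those of the induced subgraph.
  reachableEdge? : ∀ x u → Decidable (λ v → Star Edge x u × Edge u v)
  reachableEdge? x u v = reachable? x u ×-dec edge? u v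

  component : Vertex X → RawSubgraph X
  component x = subgraph (tabulate (does ∘ reachable? x))
                         (tabulate λ u → tabulate (does ∘ reachableEdge? x u))

  module _ {x : Vertex X} where

    ∈-component⁺ : ∀ {u} → Star Edge x u → u ∈ vertices (component x)
    ∈-component⁺ = ∈-tabulate⁺ (reachable? x)

    ∈-component⁻ : ∀ {u} → u ∈ vertices (component x) → Star Edge x u
    ∈-component⁻ = ∈-tabulate⁻ (reachable? x)

    private
      -- `lookup` is stuck at a variable index, so adjacency has to be transported along this
      -- equation.
      row : ∀ u → lookup (adjacency (component x)) u ≡ tabulate (does ∘ reachableEdge? x u)
      row = lookup∘tabulate _

    component-adj⁺ : ∀ {u v} → Star Edge x u → Edge u v → Adj (component x) u v
    component-adj⁺ {u} {v} xu uv =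
      subst (v ∈_) (sym (row u)) (∈-tabulate⁺ (reachableEdge? x u) (xu , uv))

    component-adj⁻ : ∀ {u v} → Adj (component x) u v → Star Edge x u × Edge u v
    component-adj⁻ {u} {v} uv = ∈-tabulate⁻ (reachableEdge? x u) (subst (v ∈_) (row u) uv)

    component-isSubgraph : IsSubgraph X (component x)
    component-isSubgraph = record
      { nonempty  = x , ∈-component⁺ ε
      ; loops     = λ u u∈ → component-adj⁺ (∈-component⁻ u∈) edge-refl
      ; symmetric = λ u v a → let xu , uv = component-adj⁻ a in
                    component-adj⁺ (xu ◅◅ uv ◅ ε) (edge-sym uv)
      ; endpoints = λ u v a → let xu , uv = component-adj⁻ a in
                    ∈-component⁺ xu , ∈-component⁺ (xu ◅◅ uv ◅ ε)
      ; edges     = λ u v a → proj₂ (component-adj⁻ a)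
      }

    -- By symmetry of edges, one can walk in `X` from `u` back to `x` and on to `v`; this walk is
    -- then lifted to the component.
    component-connected : Connected (component x)
    component-connected u v u∈ v∈ = lift xu (reverse edge-sym xu ◅◅ ∈-component⁻ v∈)
      where
      xu = ∈-component⁻ u∈
      -- The first argument records that the current vertex is reachable from `x`, which places the
      -- next edge in the component.
      lift : ∀ {u v} → Star Edge x u → Star Edge u v → Star (Adj (component x)) u v
      lift xu ε         = ε
      lift xu (uw ◅ wv) = component-adj⁺ xu uw ◅ lift (xu ◅◅ uw ◅ ε) wv

    -- A walk inside `H` from `x` is also a walk in `X`. Both maximality and uniqueness of the
    -- component rest on this.
    connected⇒⊑component : ∀ {H} → IsConnectedSubgraph X H → x ∈ vertices H → H ⊑ component x
    connected⇒⊑component {H} (sub , conn) x∈H =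
      ∈-component⁺ ∘ reach ,
      λ u v uv → component-adj⁺ (reach (proj₁ (endpoints u v uv))) (edges u v uv)
      where
      open IsSubgraph sub
      reach : ∀ {u} → u ∈ vertices H → Star Edge x u
      reach u∈H = Star.map (edges _ _) (conn x _ x∈H u∈H)

    component-isComponent : IsComponent X (component x)
    component-isComponent =
      (component-isSubgraph , component-connected) ,
      λ H H-conn (V⊆ , _) → connected⇒⊑component H-conn (V⊆ (∈-component⁺ ε))

    -- One inclusion is the previous bound on connected subgraphs; the maximality of `C`, applied to
    -- `component x`, gives the other.
    isComponent⇒≡component : ∀ {C} → IsComponent X C → x ∈ vertices C → C ≡ component x
    isComponent⇒≡component (conn , maximal) x∈C =
      ⊑-antisym C⊑ (maximal _ (component-isSubgraph , component-connected) C⊑)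
      where C⊑ = connected⇒⊑component conn x∈C

module _ {X Y : Graph} (φ : Homomorphism X Y) (y : Vertex Y) where

  private
    components : List (RawSubgraph X)
    components = filter (𝒞? φ y) (subgraphs X)

    part : RawSubgraph X → Subset (Graph.order X)
    part C = vertices C ∩ fibre φ y

    components⊆𝒞 : All (𝒞 φ y) components
    components⊆𝒞 = All.all-filter (𝒞? φ y) (subgraphs X)

  -- A shared vertex `x` would force both to equal `component x`.
  parts-disjoint : ∀ {C C′} → 𝒞 φ y C → 𝒞 φ y C′ → C ≢ C′ → Disjoint (part C) (part C′)
  parts-disjoint {C} {C′} (isC , _) (isC′ , _) C≢C′ (x , x∈) =
    let x∈C , x∈C′ = x∈p∩q⁻ (part C) (part C′) x∈ in
    C≢C′ (trans (isComponent⇒≡component isC (proj₁ (x∈p∩q⁻ (vertices C) _ x∈C)))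
           (sym (isComponent⇒≡component isC′ (proj₁ (x∈p∩q⁻ (vertices C′) _ x∈C′)))))

  ⋃-parts≡fibre : ⋃ (List.map part components) ≡ fibre φ y
  ⋃-parts≡fibre = ⊆-antisym parts⊆ ⊆parts
    where
    parts⊆ : ⋃ (List.map part components) ⊆ fibre φ y
    parts⊆ x∈ with C , x∈C ← Any.satisfied (Any.map⁻ (x∈⋃⁻ (List.map part components) x∈)) =
      proj₂ (x∈p∩q⁻ (vertices C) _ x∈C)

    ⊆parts : fibre φ y ⊆ ⋃ (List.map part components)
    ⊆parts {x} x∈ = x∈⋃⁺ (Any.map⁺ (List.lose component∈ x∈part))
      where
      x∈part : x ∈ part (component x)
      x∈part = x∈p∩q⁺ (∈-component⁺ {X} {x} ε , x∈)
      component∈ : component x List.∈ components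
      -- The positive count required by `𝒞` is witnessed by `x` itself.
      component∈ = ∈-filter⁺ (𝒞? φ y) (subgraphs-complete X (component x))
                     (component-isComponent , x∈p⇒0<∣p∣ x∈part)

  k-whole≡c*k : ComponentEquitable φ → ∀ {C} → 𝒞 φ y C → k φ (whole X) y ≡ c φ y * k φ C y
  k-whole≡c*k equitable {C} C∈𝒞 = begin
    -- The vertex set of `whole X` is the full subset, so the intersection is the fibre.
    k φ (whole X) y                             ≡⟨ cong ∣_∣ (∩-identityˡ (fibre φ y)) ⟩
    ∣ fibre φ y ∣                               ≡⟨ cong ∣_∣ ⋃-parts≡fibre ⟨
    ∣ ⋃ (List.map part components) ∣            ≡⟨ ∣⋃∣-equitable disjoint sizes ⟩
    length (List.map part components) * k φ C y ≡⟨ cong (_* k φ C y) (length-map part components) ⟩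
    c φ y * k φ C y                             ∎
    where
    open ≡-Reasoning
    disjoint : AllPairs Disjoint (List.map part components)
    disjoint = AllPairs.map⁺ (unique⇒allPairs parts-disjoint components⊆𝒞
                 (Unique.filter⁺ (𝒞? φ y) (subgraphs-unique X)))
    sizes : All (λ p → ∣ p ∣ ≡ k φ C y) (List.map part components)
    -- Equitability compares every listed component with the fixed `C`.
    sizes = All.map⁺ (All.map (λ C′∈𝒞 → equitable y _ _ C′∈𝒞 C∈𝒞) components⊆𝒞)

-- Normalisation respects equality of unnormalised fractions, so cross-multiplication suffices.
n≡m*d⇒m/1≡n/d : ∀ m {n} d .{{_ : NonZero d}} → n ≡ m * d → + m / 1 ≡ + n / d
-- `mkℚᵘ` stores the denominator minus one: `0` stands for 1 and `d` for `suc d`.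
n≡m*d⇒m/1≡n/d m (suc d) refl = fromℚᵘ-cong {mkℚᵘ (+ m) 0} {mkℚᵘ (+ (m * suc d)) d}
  (*≡* (trans (sym (pos-* m (suc d))) (sym (ℤ.*-identityʳ (+ (m * suc d))))))

proposition6p8 : (X Y : Graph) (φ : Homomorphism X Y) →
    LocallySurjective φ → ComponentEquitable φ →
    (y : Vertex Y) →
    (∀ C → (C∈𝒞 : 𝒞 φ y C) →
    (+ c φ y) / 1 ≡ _/_ (+ k φ (whole X) y) (k φ C y) {{>-nonZero (proj₂ C∈𝒞)}})
    × (∀ C → 𝒞 φ y C → k φ C y ∣ k φ (whole X) y)
proposition6p8 X Y φ _ equitable y =
  -- Membership in `𝒞` includes positivity of `k φ C y`, so the division is defined.
  (λ C C∈𝒞 → n≡m*d⇒m/1≡n/d (c φ y) (k φ C y) {{>-nonZero (proj₂ C∈𝒞)}}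
                (k-whole≡c*k φ y equitable C∈𝒞)) ,
  (λ C C∈𝒞 → divides (c φ y) (k-whole≡c*k φ y equitable C∈𝒞))
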